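{- Let $V$ be the orientation of the $3$-dimensional cube with vertices $s_1,s_2,s_3,b_1,b_2,b_3,v_1,v_2$ and the twelve arcs $\overrightarrow{b_3s_1},\ \overrightarrow{s_1s_3},\ \overrightarrow{s_3v_1},\ \overrightarrow{b_3v_1},\ \overrightarrow{b_1v_2},\ \overrightarrow{b_2v_2},\ \overrightarrow{b_2s_2},\ \overrightarrow{b_1s_2},\ \overrightarrow{b_1s_1},\ \overrightarrow{b_3v_2},\ \overrightarrow{s_2s_3},\ \overrightarrow{b_2v_1}$ (so $b_1,b_2,b_3$ have out-degree $3$ and $v_1,v_2$ have in-degree $3$). Then $V$ is not $(2,3)$-cordial.
   Context: A labeling $f$ of the vertex set $\{0,1\}$-valued is friendly if $-1\le |f^{ -1}(0)|-|f^{ -1}(1)|\le 1$. For a digraph $D=(W,A)$ and $f:W\to\{0,1\}$, the induced arc labeling is $g:A\to\{1,-1,0\}$, $g(\overrightarrow{uv})=f(v)-f(u)$. $D$ is $(2,3)$-cordial if there exists a friendly $f$ such that for all $i,j\in\{1,-1,0\}$, $-1\le |g^{ -1}(i)|-|g^{ -1}(j)|\le 1$. (The underlying undirected graph of $V$ is the 3-cube: two 4-cycles $s_1b_3v_1s_3$ and $b_1v_2b_2s_2$ joined by the edges $s_1b_1$, $b_3v_2$, $s_3s_2$, $v_1b_2$.) -}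

module Defs where

open import Data.Nat using (ℕ)
open import Data.Fin using (Fin; zero; suc)
open import Data.Fin.Base using (toℕ)
open import Data.List using (List; []; _∷_; length; filter; map)
open import Data.List.Base using (allFin)
open import Data.Product using (Σ; _×_; _,_; ∃)
open import Data.Integer as ℤ using (ℤ; +_; _-_; -[1+_])
open import Relation.Binary.PropositionalEquality using (_≡_)
import Data.Integer.Properties as ℤP
import Data.Fin.Properties as FinP

-- A digraph with vertex set Fin n, given by its list of arcs (tail , head).
record Digraph : Set where
  constructor digraph
  field
    n    : ℕ
    arcs : List (Fin n × Fin n)
open Digraph public

Labeling : Digraph → Set
Labeling D = Fin (n D) → Fin 2

val : Fin 2 → ℤ
val x = + (toℕ x)

vcount : (D : Digraph) → Labeling D → Fin 2 → ℕ
vcount D f a = length (filter (λ v → f v FinP.≟ a) (allFin (n D)))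

Friendly : (D : Digraph) → Labeling D → Set
Friendly D f = (-[1+ 0 ] ℤ.≤ d) × (d ℤ.≤ + 1)
  where d = + vcount D f zero - + vcount D f (suc zero)

arcLabel : (D : Digraph) → Labeling D → Fin (n D) × Fin (n D) → ℤ
arcLabel D f (u , v) = val (f v) - val (f u)

acount : (D : Digraph) → Labeling D → ℤ → ℕ
acount D f i = length (filter (λ a → arcLabel D f a ℤP.≟ i) (arcs D))

data ArcVal : Set where
  one minusOne zer : ArcVal

toℤ : ArcVal → ℤ
toℤ one = + 1
toℤ minusOne = -[1+ 0 ]
toℤ zer = + 0

Cordial23 : Digraph → Set
Cordial23 D = Σ (Labeling D) λ f → Friendly D f ×
  ((i j : ArcVal) →
     let d = + acount D f (toℤ i) - + acount D f (toℤ j)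
     in (-[1+ 0 ] ℤ.≤ d) × (d ℤ.≤ + 1))

s1 s2 s3 b1 b2 b3 v1 v2 : Fin 8
s1 = zero
s2 = suc zero
s3 = suc (suc zero)
b1 = suc (suc (suc zero))
b2 = suc (suc (suc (suc zero)))
b3 = suc (suc (suc (suc (suc zero))))
v1 = suc (suc (suc (suc (suc (suc zero)))))
v2 = suc (suc (suc (suc (suc (suc (suc zero))))))

V : Digraph
V = digraph 8
  ( (b3 , s1) ∷ (s1 , s3) ∷ (s3 , v1) ∷ (b3 , v1)
  ∷ (b1 , v2) ∷ (b2 , v2) ∷ (b2 , s2) ∷ (b1 , s2)
  ∷ (b1 , s1) ∷ (b3 , v2) ∷ (s2 , s3) ∷ (b2 , v1) ∷ [])

{-# OPTIONS --safe #-}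
module Submission where

open import Defs
open import Relation.Nullary using (¬_; Dec)
open import Data.Fin using (Fin; zero; suc)
import Data.Fin.Properties as FinP
open FinP using (any?)
open import Data.Integer using (+_; _-_; -[1+_]; _≤_)
open import Data.Integer.Properties using (_≤?_; _≟_)
open import Data.List using (length; allFin)
open import Data.List.Properties using (filter-≐)
open import Data.Nat using (ℕ; zero; suc)
open import Data.Product using (_×_; _,_; ∃)
open import Data.Vec using (Vec; []; _∷_; lookup; tabulate)
open import Data.Vec.Properties using (lookup∘tabulate)
open import Relation.Binary.PropositionalEquality
  using (_≡_; _≗_; sym; trans; cong; cong₂; subst₂)
open import Relation.Nullary.Decidable using (map′; _×-dec_; from-no)
open import Relation.Unary using (Pred; Decidable)

-- The proof is an exhaustive check. A digraph on n vertices has only 2^n labelings, and the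
-- conditions on each are finitely many integer inequalities, so `Cordial23` is decidable
-- (`cordial23?`). For `V` none of the 256 labelings passes. `anyVec?` supplies the search and
-- `isCordial-cong` ensures that no labeling escapes it.

-- Induction on the length: try every head, and for each head search the tails.
anyVec? : ∀ {p} {k} n {P : Pred (Vec (Fin k) n) p} → Decidable P → Dec (∃ P)
anyVec? zero P? = map′ (λ p → [] , p) (λ { ([] , p) → p }) (P? [])
anyVec? (suc n) P? =
  map′ (λ { (x , xs , p) → x ∷ xs , p }) (λ { (x ∷ xs , p) → x , xs , p })
       (any? λ x → anyVec? n λ xs → P? (x ∷ xs))

allArcVals? : ∀ {p} {P : Pred ArcVal p} → Decidable P → Dec (∀ i → P i)
allArcVals? P? =
  map′ (λ { (p , q , r) → λ { one → p ; minusOne → q ; zer → r } })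
       (λ h → h one , h minusOne , h zer)
       (P? one ×-dec P? minusOne ×-dec P? zer)

Balanced : ℕ → ℕ → Set
Balanced a b = (-[1+ 0 ] ≤ + a - + b) × (+ a - + b ≤ + 1)

balanced? : ∀ a b → Dec (Balanced a b)
balanced? a b = (-[1+ 0 ] ≤? + a - + b) ×-dec (+ a - + b ≤? + 1)

-- Definitionally the body of the `Σ` in `Cordial23`, so witnesses pass between the two unchanged.
IsCordial : (D : Digraph) → Labeling D → Set
IsCordial D f =
  Friendly D f × (∀ i j → Balanced (acount D f (toℤ i)) (acount D f (toℤ j)))

isCordial? : ∀ D f → Dec (IsCordial D f)
isCordial? D f =
  balanced? (vcount D f zero) (vcount D f (suc zero)) ×-dec
  allArcVals? λ i → allArcVals? λ j →
    balanced? (acount D f (toℤ i)) (acount D f (toℤ j))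

vcount-cong : ∀ D {f g : Labeling D} → f ≗ g → ∀ a → vcount D f a ≡ vcount D g a
vcount-cong D {f} {g} f≗g a = cong length
  (filter-≐ (λ v → f v FinP.≟ a) (λ v → g v FinP.≟ a)
    ((λ {v} → trans (sym (f≗g v))) , (λ {v} → trans (f≗g v)))
    (allFin (n D)))

acount-cong : ∀ D {f g : Labeling D} → f ≗ g → ∀ i → acount D f i ≡ acount D g i
acount-cong D {f} {g} f≗g i = cong length
  (filter-≐ (λ a → arcLabel D f a ≟ i) (λ a → arcLabel D g a ≟ i)
    ((λ {a} → trans (sym (label≡ a))) , (λ {a} → trans (label≡ a)))
    (arcs D))
  where
  label≡ : arcLabel D f ≗ arcLabel D g
  label≡ (u , v) = cong₂ (λ x y → val x - val y) (f≗g v) (f≗g u)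

-- Cordiality sees a labeling only through its vertex and arc counts, which depend on its values
-- alone. This carries it from `f` to the lookup in the table of `f`, which agrees with `f` only
-- pointwise.
isCordial-cong : ∀ D {f g : Labeling D} → f ≗ g → IsCordial D f → IsCordial D g
isCordial-cong D f≗g (friendly , balanced) =
  subst₂ Balanced (vcount-cong D f≗g zero) (vcount-cong D f≗g (suc zero)) friendly ,
  λ i j → subst₂ Balanced (acount-cong D f≗g (toℤ i)) (acount-cong D f≗g (toℤ j))
                 (balanced i j)

-- Labelings are replaced by vectors to make the search finite without function
-- extensionality.
cordial23? : ∀ D → Dec (Cordial23 D)
cordial23? D =
  map′ (λ { (xs , c) → lookup xs , c })
       (λ { (f , c) → tabulate f ,
                      isCordial-cong D (λ v → sym (lookup∘tabulate f v)) c })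
       (anyVec? (n D) λ xs → isCordial? D (lookup xs))

theorem2 : ¬ Cordial23 V
-- Type checking runs the search: `from-no` yields a refutation only because the decision evaluates
-- to `no`.
theorem2 = from-no (cordial23? V)
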